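{- Let $\mathcal{F}=\mathcal{B}(K_3)$. For every odd integer $n\ge 3$ with $n\ne 5$, $f(n,\mathcal{F})=2^{n-2}$.
   Context: For a graph $G$, a hypergraph $H$ is a Berge-$G$ hypergraph if there are an injective map $\phi:V(G)\to V(H)$ and pairwise distinct hyperedges $e_{xy}\in E(H)$, one for each $xy\in E(G)$, with $\phi(x),\phi(y)\in e_{xy}$. $\mathcal{B}(G)$ denotes the family of all Berge-$G$ hypergraphs. For a positive integer $n$ and a graph $G$, $f(n,\mathcal{B}(G))$ is the smallest number of colors in a coloring of all subsets of $[n]=\{1,\dots,n\}$ (i.e. of $2^{[n]}$) such that there is no monochromatic Berge-$G$ hypergraph, i.e. no color class, viewed as a (non-uniform) hypergraph on $[n]$, contains a Berge-$G$ subhypergraph. -}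

module Defs where

open import Level using (0ℓ)
open import Data.Nat using (ℕ; _≤_)
open import Data.Fin using (Fin; _≟_)
open import Data.Fin.Subset using (Subset; _∈_)
open import Data.Product using (_×_; ∃-syntax)
open import Data.Sum using (_⊎_)
open import Function.Definitions using (Injective)
open import Relation.Binary.Core using (Rel)
open import Relation.Binary.Definitions using (Symmetric; Irreflexive; Decidable)
open import Relation.Binary.PropositionalEquality using (_≡_; _≢_; refl; ≢-sym)
open import Relation.Nullary using (¬_)
open import Relation.Nullary.Decidable using (¬?)
import Relation.Unary as U

record Graph : Set₁ where
  field
    order  : ℕ
    Adj    : Rel (Fin order) 0ℓ
    sym    : Symmetric Adj
    irrefl : Irreflexive _≡_ Adj
    adj?   : Decidable Adj

K : ℕ → Graph
K m = record
  { order  = m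
  ; Adj    = _≢_
  ; sym    = ≢-sym
  ; irrefl = λ x≡y x≢y → x≢y x≡y
  ; adj?   = λ x y → ¬? (x ≟ y)
  }

-- A non-uniform hypergraph on the vertex set [n], modelled by Fin n, is given
-- by its set of hyperedges.

Hypergraph : ℕ → Set₁
Hypergraph n = U.Pred (Subset n) 0ℓ

Family : Set₁
Family = ∀ {n} → Hypergraph n → Set

-- The hyperedge assigned to the edge xy is `edge x y`; it does not depend on
-- the order of x and y, and its values at non-adjacent pairs are irrelevant.

record IsBerge (G : Graph) {n : ℕ} (H : Hypergraph n) : Set where
  open Graph G
  field
    φ        : Fin order → Fin n
    φ-inj    : Injective _≡_ _≡_ φ
    edge     : Fin order → Fin order → Subset n
    edge-sym : ∀ {x y} → Adj x y → edge x y ≡ edge y x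
    edge∈H   : ∀ {x y} → Adj x y → edge x y U.∈ H
    distinct : ∀ {x y u v} → Adj x y → Adj u v → edge x y ≡ edge u v →
               (x ≡ u × y ≡ v) ⊎ (x ≡ v × y ≡ u)
    incident : ∀ {x y} → Adj x y → φ x ∈ edge x y × φ y ∈ edge x y

𝓑 : Graph → Family
𝓑 G H = IsBerge G H

-- Only spanning subhypergraphs are considered: the vertex set does not affect
-- the property of being Berge-G beyond containing the image of φ.

Contains : Family → ∀ {n} → Hypergraph n → Set₁
Contains 𝓕 {n} H = ∃[ H′ ] (H′ U.⊆ H) × 𝓕 {n} H′

Colouring : ℕ → ℕ → Set
Colouring n k = Subset n → Fin k

colourClass : ∀ {n k} → Colouring n k → Fin k → Hypergraph n
colourClass c i A = c A ≡ i

NoMonochromatic : Family → ∀ {n k} → Colouring n k → Set₁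
NoMonochromatic 𝓕 c = ∀ i → ¬ Contains 𝓕 (colourClass c i)

Colourable : ℕ → Family → ℕ → Set₁
Colourable n 𝓕 k = ∃[ c ] NoMonochromatic 𝓕 {n} {k} c

-- f(n, 𝓕) = k.  This is a relation because for some families no number of
-- colours suffices.

f[_,_]≡_ : ℕ → Family → ℕ → Set₁
f[ n , 𝓕 ]≡ k = Colourable n 𝓕 k × (∀ j → Colourable n 𝓕 j → k ≤ j)

{-# OPTIONS --safe #-}
-- Upper bound: a class {A, ∁A, B, ∁B} contains no Berge triangle, because the
-- three edges of a Berge triangle pairwise intersect while two of any three
-- members of the class are complementary.  Lower bound: write n = 2k + 1.  One of
-- each complementary pair has more than k elements, so there are 2ⁿ⁻¹ such large
-- sets.  Three distinct large sets satisfy Hall's condition for distinct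
-- representatives of their pairwise intersections when k ∉ {0, 2}, so they form a
-- Berge triangle and each colour is used on at most two of them.
module Submission where

open import Defs
open import Data.Bool using (Bool; true; false; not)
open import Data.Bool.Properties using (not-involutive)
open import Data.Fin using (Fin; zero; suc; combine; _<_)
import Data.Fin as Fin
open import Data.Fin.Properties
  using (_<?_; any?; all?; <-cmp; <⇒≢; <-trans; combine-injective; injective⇒≤; *↔×; 2↔Bool)
open import Data.Fin.Subset using (Subset; _∈_; _⊆_; _∪_; _∩_; ∁; ∣_∣; ⁅_⁆; Nonempty; outside)
open import Data.Fin.Subset.Properties
open import Data.Nat using (ℕ; zero; suc; _+_; _*_; _≤_; _^_; _∸_; _%_; _/_; s≤s)
import Data.Nat as ℕ
open import Data.Nat.DivMod using (m≡m%n+[m/n]*n)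
import Data.Nat.Properties as ℕ
open import Data.Nat.Tactic.RingSolver using (solve-∀)
open import Data.Product using (∃-syntax; _×_; _,_; proj₁; proj₂)
open import Data.Product.Function.NonDependent.Propositional using (_×-↔_)
open import Data.Sum using (_⊎_; inj₁; inj₂; [_,_]′)
import Data.Sum as Sum
open import Data.Vec using ([]; _∷_; head; tail; uncons)
open import Data.Vec.Properties using (map-∘; map-cong; map-id)
open import Function using (_∘_; _↔_; Injective; Inverse; mk↔ₛ′; Injection)
open import Function.Construct.Composition using (_↔-∘_)
open import Function.Construct.Symmetry using (↔-sym)
open import Function.Properties.Inverse using (↔⇒↣)
open import Relation.Binary.Definitions using (tri<; tri≈; tri>)
open import Relation.Binary.PropositionalEquality
  using (_≡_; _≢_; refl; sym; trans; cong; cong₂; subst; ≢-sym)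
open import Relation.Nullary using (Dec; yes; no; ¬_; contradiction)
open import Relation.Nullary.Decidable using (_×-dec_; _→-dec_; ¬?; _⊎-dec_; from-yes)

private
  variable
    m n : ℕ

-- Triples, the enumeration of subsets, and a pigeonhole bound.

choose : ∀ {a} {A : Set a} → A → A → A → Fin 3 → A
choose x y z zero             = x
choose x y z (suc zero)       = y
choose x y z (suc (suc zero)) = z

choose-injective : ∀ {a} {A : Set a} {x y z : A} → x ≢ y → y ≢ z → x ≢ z →
                   Injective _≡_ _≡_ (choose x y z)
choose-injective x≢y y≢z x≢z {zero}           {zero}           _  = refl
choose-injective x≢y y≢z x≢z {zero}           {suc zero}       eq = contradiction eq x≢y
choose-injective x≢y y≢z x≢z {zero}           {suc (suc zero)} eq = contradiction eq x≢z
choose-injective x≢y y≢z x≢z {suc zero}       {zero}           eq = contradiction (sym eq) x≢y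
choose-injective x≢y y≢z x≢z {suc zero}       {suc zero}       _  = refl
choose-injective x≢y y≢z x≢z {suc zero}       {suc (suc zero)} eq = contradiction eq y≢z
choose-injective x≢y y≢z x≢z {suc (suc zero)} {zero}           eq = contradiction (sym eq) x≢z
choose-injective x≢y y≢z x≢z {suc (suc zero)} {suc zero}       eq = contradiction (sym eq) y≢z
choose-injective x≢y y≢z x≢z {suc (suc zero)} {suc (suc zero)} _  = refl

-- Serves both bounds: forwards it turns a subset into a colour, backwards it enumerates the sets to
-- be coloured.
subset↔fin : ∀ n → Subset n ↔ Fin (2 ^ n)
subset↔fin zero    = mk↔ₛ′ (λ _ → zero) (λ _ → []) (λ { zero → refl }) (λ { [] → refl })
subset↔fin (suc n) =
  ↔-sym (*↔× {2} {2 ^ n}) ↔-∘ ((↔-sym 2↔Bool ×-↔ subset↔fin n) ↔-∘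
  mk↔ₛ′ uncons (λ (b , p) → b ∷ p) (λ _ → refl) (λ { (b ∷ p) → refl }))

-- Pairing f x with a bit telling whether the value f x was already taken below x
-- gives an injection.
at-most-two-to-one⇒≤ : ∀ {m j} (f : Fin m → Fin j) →
                       (∀ {x y z} → x ≢ y → y ≢ z → x ≢ z → f x ≡ f y → ¬ f y ≡ f z) →
                       m ≤ j * 2
at-most-two-to-one⇒≤ {m} {j} f two-to-one = injective⇒≤ {f = g} g-injective
  where
  earlier? : ∀ x → Dec (∃[ w ] (w < x × f w ≡ f x))
  earlier? x = any? (λ w → (w <? x) ×-dec (f w Fin.≟ f x))

  flag : ∀ {P : Set} → Dec P → Fin 2
  flag (yes _) = suc zero
  flag (no  _) = zero

  g : Fin m → Fin (j * 2)
  g x = combine (f x) (flag (earlier? x))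

  collision : ∀ {x y} → x < y → g x ≢ g y
  collision {x} {y} x<y eq
    with fx≡fy , flags ← combine-injective (f x) (flag (earlier? x)) (f y) (flag (earlier? y)) eq
    with earlier? x | earlier? y
  -- Equal flags are impossible: if `x` has an earlier `w`, then `w`, `x`, `y` share a value;
  -- otherwise `x` itself is the earlier point that sets the flag of `y`.
  ... | yes (w , w<x , fw≡fx) | _ =
    two-to-one (<⇒≢ w<x) (<⇒≢ x<y) (<⇒≢ (<-trans w<x x<y)) fw≡fx fx≡fy
  ... | no _ | no none = none (x , x<y , fx≡fy)
  ... | no _ | yes _   = contradiction flags (λ ())

  g-injective : Injective _≡_ _≡_ g
  g-injective {x} {y} eq with <-cmp x y
  ... | tri< x<y _ _ = contradiction eq (collision x<y)
  ... | tri≈ _ x≡y _ = x≡y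
  ... | tri> _ _ y<x = contradiction (sym eq) (collision y<x)

-- Complementary pairs and the colouring for the upper bound.

∁-involutive : (p : Subset n) → ∁ (∁ p) ≡ p
∁-involutive p = trans (sym (map-∘ not not p)) (trans (map-cong not-involutive p) (map-id p))

-- A pair {p, ∁ p} is represented by its member that avoids the first point.
half : Subset (suc n) → Subset n
half (false ∷ p) = p
half (true  ∷ p) = ∁ p

half≡⇒≡⊎≡∁ : (p q : Subset (suc n)) → half p ≡ half q → p ≡ q ⊎ p ≡ ∁ q
half≡⇒≡⊎≡∁ (false ∷ p) (false ∷ q) eq = inj₁ (cong (false ∷_) eq)
half≡⇒≡⊎≡∁ (false ∷ p) (true  ∷ q) eq = inj₂ (cong (false ∷_) eq)
half≡⇒≡⊎≡∁ (true  ∷ p) (false ∷ q) eq =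
  inj₂ (cong (true ∷_) (trans (sym (∁-involutive p)) (cong ∁ eq)))
half≡⇒≡⊎≡∁ (true  ∷ p) (true  ∷ q) eq =
  inj₁ (cong (true ∷_) (trans (sym (∁-involutive p)) (trans (cong ∁ eq) (∁-involutive q))))

-- The fibres are {p, ∁ p, q, ∁ q}, where q is p with the second point toggled.
quadruple : Subset (suc (suc m)) → Subset m
quadruple p = tail (half p)

-- If the heads agreed as well, `p` and `q` would be equal or complementary, and the common point
-- `v` excludes complements. Hence intersecting distinct sets of one colour are told apart by a
-- single bit.
quadruple-separates : ∀ {p q : Subset (suc (suc m))} {v} → p ≢ q → v ∈ p → v ∈ q →
                      quadruple p ≡ quadruple q → head (half p) ≢ head (half q)
quadruple-separates {p = p} {q} p≢q v∈p v∈q tails heads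
  with half≡⇒≡⊎≡∁ p q (uncons-≡ (half p) (half q) heads tails)
  where
  uncons-≡ : ∀ {n} (s t : Subset (suc n)) → head s ≡ head t → tail s ≡ tail t → s ≡ t
  uncons-≡ (_ ∷ _) (_ ∷ _) = cong₂ _∷_
... | inj₁ p≡q  = p≢q p≡q
... | inj₂ refl = x∈∁p⇒x∉p v∈p v∈q

no-three-distinct-bools : {a b c : Bool} → a ≢ b → b ≢ c → ¬ (a ≢ c)
no-three-distinct-bools {false} {false}         a≢b _   _   = a≢b refl
no-three-distinct-bools {true}  {true}          a≢b _   _   = a≢b refl
no-three-distinct-bools {false} {true}  {true}  _   b≢c _   = b≢c refl
no-three-distinct-bools {false} {true}  {false} _   _   a≢c = a≢c refl
no-three-distinct-bools {true}  {false} {false} _   b≢c _   = b≢c refl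
no-three-distinct-bools {true}  {false} {true}  _   _   a≢c = a≢c refl

colourable-2^ : ∀ m → Colourable (2 + m) (𝓑 (K 3)) (2 ^ m)
colourable-2^ m = colour , no-triangle
  where
  colour : Colouring (2 + m) (2 ^ m)
  colour p = Inverse.to (subset↔fin m) (quadruple p)

  no-triangle : NoMonochromatic (𝓑 (K 3)) colour
  -- The edges 01, 12 and 02 meet pairwise in the images of the vertices 1, 2 and 0, so their three
  -- bits would have to be pairwise different.
  no-triangle i (H , H⊆class , berge) =
    no-three-distinct-bools
      (separate 0≢1 1≢2 (λ { (inj₁ (() , _)) ; (inj₂ (() , _)) })
        (proj₂ (incident 0≢1)) (proj₁ (incident 1≢2)))
      (separate 1≢2 0≢2 (λ { (inj₁ (() , _)) ; (inj₂ (() , _)) })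
        (proj₂ (incident 1≢2)) (proj₂ (incident 0≢2)))
      (separate 0≢1 0≢2 (λ { (inj₁ (_ , ())) ; (inj₂ (() , _)) })
        (proj₁ (incident 0≢1)) (proj₁ (incident 0≢2)))
    where
    open IsBerge berge

    0≢1 : zero {2} ≢ suc zero
    0≢1 ()
    0≢2 : zero {2} ≢ suc (suc zero)
    0≢2 ()
    1≢2 : suc (zero {1}) ≢ suc (suc zero)
    1≢2 ()

    separate : ∀ {x y u v w} (xy : x ≢ y) (uv : u ≢ v) →
               ¬ ((x ≡ u × y ≡ v) ⊎ (x ≡ v × y ≡ u)) →
               w ∈ edge x y → w ∈ edge u v →
               head (half (edge x y)) ≢ head (half (edge u v))
    separate xy uv different w∈xy w∈uv =
      quadruple-separates (different ∘ distinct xy uv) w∈xy w∈uv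
        (Injection.injective (↔⇒↣ (subset↔fin m))
          (trans (H⊆class (edge∈H xy)) (sym (H⊆class (edge∈H uv)))))

-- Cardinalities of unions and intersections.

∣p∪q∣+∣p∩q∣≡∣p∣+∣q∣ : (p q : Subset n) → ∣ p ∪ q ∣ + ∣ p ∩ q ∣ ≡ ∣ p ∣ + ∣ q ∣
∣p∪q∣+∣p∩q∣≡∣p∣+∣q∣ []          []          = refl
∣p∪q∣+∣p∩q∣≡∣p∣+∣q∣ (false ∷ p) (false ∷ q) = ∣p∪q∣+∣p∩q∣≡∣p∣+∣q∣ p q
∣p∪q∣+∣p∩q∣≡∣p∣+∣q∣ (true  ∷ p) (false ∷ q) = cong suc (∣p∪q∣+∣p∩q∣≡∣p∣+∣q∣ p q)
∣p∪q∣+∣p∩q∣≡∣p∣+∣q∣ (false ∷ p) (true  ∷ q) =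
  trans (cong suc (∣p∪q∣+∣p∩q∣≡∣p∣+∣q∣ p q)) (sym (ℕ.+-suc ∣ p ∣ ∣ q ∣))
∣p∪q∣+∣p∩q∣≡∣p∣+∣q∣ (true  ∷ p) (true  ∷ q) = cong suc
  (trans (ℕ.+-suc ∣ p ∪ q ∣ ∣ p ∩ q ∣)
    (trans (cong suc (∣p∪q∣+∣p∩q∣≡∣p∣+∣q∣ p q)) (sym (ℕ.+-suc ∣ p ∣ ∣ q ∣))))

∣p∣+∣q∣≤n+∣p∩q∣ : (p q : Subset n) → ∣ p ∣ + ∣ q ∣ ≤ n + ∣ p ∩ q ∣
∣p∣+∣q∣≤n+∣p∩q∣ {n} p q = begin
  ∣ p ∣ + ∣ q ∣         ≡⟨ ∣p∪q∣+∣p∩q∣≡∣p∣+∣q∣ p q ⟨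
  ∣ p ∪ q ∣ + ∣ p ∩ q ∣ ≤⟨ ℕ.+-monoˡ-≤ ∣ p ∩ q ∣ (∣p∣≤n (p ∪ q)) ⟩
  n + ∣ p ∩ q ∣         ∎
  where open ℕ.≤-Reasoning

∣p∪q∣≤∣p∣∧∣p∪q∣≤∣q∣⇒p≡q : (p q : Subset n) → ∣ p ∪ q ∣ ≤ ∣ p ∣ → ∣ p ∪ q ∣ ≤ ∣ q ∣ → p ≡ q
∣p∪q∣≤∣p∣∧∣p∪q∣≤∣q∣⇒p≡q []          []          _       _       = refl
∣p∪q∣≤∣p∣∧∣p∪q∣≤∣q∣⇒p≡q (false ∷ p) (false ∷ q) ≤p      ≤q      =
  cong (false ∷_) (∣p∪q∣≤∣p∣∧∣p∪q∣≤∣q∣⇒p≡q p q ≤p ≤q)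
∣p∪q∣≤∣p∣∧∣p∪q∣≤∣q∣⇒p≡q (true  ∷ p) (true  ∷ q) (s≤s ≤p) (s≤s ≤q) =
  cong (true ∷_) (∣p∪q∣≤∣p∣∧∣p∪q∣≤∣q∣⇒p≡q p q ≤p ≤q)
∣p∪q∣≤∣p∣∧∣p∪q∣≤∣q∣⇒p≡q (true  ∷ p) (false ∷ q) _       ≤q      =
  contradiction (∣q∣≤∣p∪q∣ p q) (ℕ.<⇒≱ ≤q)
∣p∪q∣≤∣p∣∧∣p∪q∣≤∣q∣⇒p≡q (false ∷ p) (true  ∷ q) ≤p      _       =
  contradiction (∣p∣≤∣p∪q∣ p q) (ℕ.<⇒≱ ≤p)

-- Hall's theorem for two and three sets.

0<∣p∣⇒Nonempty : (p : Subset n) → 0 ℕ.< ∣ p ∣ → Nonempty p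
0<∣p∣⇒Nonempty {n} p 0<∣p∣ with nonempty? p
... | yes nonempty = nonempty
... | no  empty    =
  contradiction (trans (cong ∣_∣ (Empty-unique empty)) (∣⊥∣≡0 n)) (≢-sym (ℕ.<⇒≢ 0<∣p∣))

-- The complement of a point has `m` of the `suc m` points, so the bound on `∣ p ∣ + ∣ ∁ ⁅ x ⁆ ∣`
-- gives this whether or not `x` lies in `p`.
∣p∣≤1+∣p∩∁⁅x⁆∣ : (p : Subset n) (x : Fin n) → ∣ p ∣ ≤ suc ∣ p ∩ ∁ ⁅ x ⁆ ∣
∣p∣≤1+∣p∩∁⁅x⁆∣ {suc m} p x = ℕ.+-cancelʳ-≤ m _ _ (begin
  ∣ p ∣ + m                   ≡⟨ cong (λ k → ∣ p ∣ + (suc m ∸ k)) (∣⁅x⁆∣≡1 x) ⟨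
  ∣ p ∣ + (suc m ∸ ∣ ⁅ x ⁆ ∣) ≡⟨ cong (∣ p ∣ +_) (∣∁p∣≡n∸∣p∣ ⁅ x ⁆) ⟨
  ∣ p ∣ + ∣ ∁ ⁅ x ⁆ ∣         ≤⟨ ∣p∣+∣q∣≤n+∣p∩q∣ p (∁ ⁅ x ⁆) ⟩
  suc (m + ∣ p ∩ ∁ ⁅ x ⁆ ∣)   ≡⟨ cong suc (ℕ.+-comm m _) ⟩
  suc ∣ p ∩ ∁ ⁅ x ⁆ ∣ + m     ∎)
  where open ℕ.≤-Reasoning

∈-∩∁⁅⁆⁻ : ∀ {p : Subset n} {x w} → w ∈ p ∩ ∁ ⁅ x ⁆ → w ∈ p × w ≢ x
∈-∩∁⁅⁆⁻ {p = p} {x} w∈ with w∈p , w∉ ← x∈p∩q⁻ p (∁ ⁅ x ⁆) w∈ =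
  w∈p , λ { refl → x∈∁p⇒x∉p w∉ (x∈⁅x⁆ x) }

second-element : (p : Subset n) → 2 ≤ ∣ p ∣ → ∀ x → ∃[ w ] (w ∈ p × w ≢ x)
second-element p 2≤∣p∣ x
  with w , w∈ ← 0<∣p∣⇒Nonempty (p ∩ ∁ ⁅ x ⁆) (ℕ.s≤s⁻¹ (ℕ.≤-trans 2≤∣p∣ (∣p∣≤1+∣p∩∁⁅x⁆∣ p x))) =
  w , ∈-∩∁⁅⁆⁻ w∈

third-element : (p : Subset n) → 3 ≤ ∣ p ∣ → ∀ x y → ∃[ w ] (w ∈ p × w ≢ x × w ≢ y)
third-element p 3≤∣p∣ x y
  with w , w∈ , w≢y ← second-element (p ∩ ∁ ⁅ x ⁆) (ℕ.s≤s⁻¹ (ℕ.≤-trans 3≤∣p∣ (∣p∣≤1+∣p∩∁⁅x⁆∣ p x))) y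
  with w∈p , w≢x ← ∈-∩∁⁅⁆⁻ w∈ = w , w∈p , w≢x , w≢y

-- Arbitrary elements are chosen first. If they coincide, another point of the union replaces the
-- representative of whichever set contains it.
hall₂ : (p q : Subset n) → 1 ≤ ∣ p ∣ → 1 ≤ ∣ q ∣ → 2 ≤ ∣ p ∪ q ∣ →
        ∃[ x ] ∃[ y ] (x ∈ p × y ∈ q × x ≢ y)
hall₂ p q 1≤p 1≤q 2≤p∪q
  with x , x∈p ← 0<∣p∣⇒Nonempty p 1≤p
  with y , y∈q ← 0<∣p∣⇒Nonempty q 1≤q
  with x Fin.≟ y
... | no x≢y = x , y , x∈p , y∈q , x≢y
... | yes refl with w , w∈ , w≢x ← second-element (p ∪ q) 2≤p∪q x with x∈p∪q⁻ p q w∈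
...   | inj₁ w∈p = w , x , w∈p , y∈q , w≢x
...   | inj₂ w∈q = x , w , x∈p , w∈q , ≢-sym w≢x

DistinctRepresentatives : (p q r : Subset n) → Set
DistinctRepresentatives p q r =
  ∃[ x ] ∃[ y ] ∃[ z ] ((x ∈ p × y ∈ q × z ∈ r) × (x ≢ y × y ≢ z × x ≢ z))

-- With r ⊆ {x, y} and a spare w ∈ p: either x represents r and w replaces x, or
-- r = {y} and q has an element v ≠ y, while p has two candidates x and w.
hall₃-augment : (p q r : Subset n) → 1 ≤ ∣ r ∣ → 2 ≤ ∣ q ∪ r ∣ →
                ∀ {x y w} → x ∈ p → y ∈ q → w ∈ p → w ≢ x → w ≢ y → x ≢ y →
                (∀ {z} → z ∈ r → z ≡ x ⊎ z ≡ y) → DistinctRepresentatives p q r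
hall₃-augment p q r 1≤r 2≤q∪r {x} {y} {w} x∈p y∈q w∈p w≢x w≢y x≢y r⊆xy with x ∈? r
... | yes x∈r = w , y , x , (w∈p , y∈q , x∈r) , (w≢y , ≢-sym x≢y , w≢x)
... | no  x∉r with v , v∈q∪r , v≢y ← second-element (q ∪ r) 2≤q∪r y = finish
  where
  r⊆y : ∀ {z} → z ∈ r → z ≡ y
  r⊆y z∈r with r⊆xy z∈r
  ... | inj₁ refl = contradiction z∈r x∉r
  ... | inj₂ z≡y  = z≡y

  y∈r : y ∈ r
  y∈r with z , z∈r ← 0<∣p∣⇒Nonempty r 1≤r = subst (_∈ r) (r⊆y z∈r) z∈r

  v∈q : v ∈ q
  v∈q with x∈p∪q⁻ q r v∈q∪r
  ... | inj₁ v∈q = v∈q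
  ... | inj₂ v∈r = contradiction (r⊆y v∈r) v≢y

  finish : DistinctRepresentatives p q r
  finish with x Fin.≟ v
  ... | no x≢v   = x , v , y , (x∈p , v∈q , y∈r) , (x≢v , v≢y , x≢y)
  ... | yes refl = w , v , y , (w∈p , v∈q , y∈r) , (w≢x , v≢y , w≢y)

-- Representatives of `p` and `q` come from `hall₂`. If `r` offers no new point, a third point of
-- the whole union must lie in `p` or `q`, and it frees a representative by an exchange.
hall₃ : (p q r : Subset n) → 1 ≤ ∣ p ∣ → 1 ≤ ∣ q ∣ → 1 ≤ ∣ r ∣ →
        2 ≤ ∣ p ∪ q ∣ → 2 ≤ ∣ q ∪ r ∣ → 2 ≤ ∣ p ∪ r ∣ → 3 ≤ ∣ (p ∪ q) ∪ r ∣ →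
        DistinctRepresentatives p q r
hall₃ p q r 1≤p 1≤q 1≤r 2≤p∪q 2≤q∪r 2≤p∪r 3≤p∪q∪r
  with x , y , x∈p , y∈q , x≢y ← hall₂ p q 1≤p 1≤q 2≤p∪q
  with any? (λ z → (z ∈? r) ×-dec (¬? (z Fin.≟ x) ×-dec ¬? (z Fin.≟ y)))
... | yes (z , z∈r , z≢x , z≢y) =
  x , y , z , (x∈p , y∈q , z∈r) , (x≢y , ≢-sym z≢y , ≢-sym z≢x)
... | no none = augment
  where
  r⊆xy : ∀ {z} → z ∈ r → z ≡ x ⊎ z ≡ y
  r⊆xy {z} z∈r with z Fin.≟ x | z Fin.≟ y
  ... | yes z≡x | _       = inj₁ z≡x
  ... | no _    | yes z≡y = inj₂ z≡y
  ... | no z≢x  | no z≢y  = contradiction (z , z∈r , z≢x , z≢y) none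

  augment : DistinctRepresentatives p q r
  augment with w , w∈ , w≢x , w≢y ← third-element ((p ∪ q) ∪ r) 3≤p∪q∪r x y
    with x∈p∪q⁻ (p ∪ q) r w∈
  ... | inj₂ w∈r = contradiction (w , w∈r , w≢x , w≢y) none
  ... | inj₁ w∈p∪q with x∈p∪q⁻ p q w∈p∪q
  ...   | inj₁ w∈p = hall₃-augment p q r 1≤r 2≤q∪r x∈p y∈q w∈p w≢x w≢y x≢y r⊆xy
  -- The same exchange with `p` and `q` interchanged; the result is permuted back.
  ...   | inj₂ w∈q
    with y′ , x′ , z′ , (y′∈q , x′∈p , z′∈r) , (y′≢x′ , x′≢z′ , y′≢z′) ←
           hall₃-augment q p r 1≤r 2≤p∪r y∈q x∈p w∈q w≢y w≢x (≢-sym x≢y) (Sum.swap ∘ r⊆xy) =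
    x′ , y′ , z′ , (x′∈p , y′∈q , z′∈r) , (≢-sym y′≢x′ , y′≢z′ , x′≢z′)

∪-lub : (p q : Subset n) {s : Subset n} → p ⊆ s → q ⊆ s → p ∪ q ⊆ s
∪-lub p q p⊆s q⊆s = [ p⊆s , q⊆s ]′ ∘ x∈p∪q⁻ p q

-- Sets containing more than half of the points.

Large : ∀ k → Subset (1 + k * 2) → Set
Large k p = suc k ≤ ∣ p ∣

module _ {k : ℕ} where

  private
    N = 1 + k * 2

  large-∩ : (p q : Subset N) → Large k p → Large k q → 1 ≤ ∣ p ∩ q ∣
  large-∩ p q lp lq = ℕ.+-cancelˡ-≤ N _ _ (begin
    N + 1             ≡⟨ arith k ⟩
    suc k + suc k     ≤⟨ ℕ.+-mono-≤ lp lq ⟩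
    ∣ p ∣ + ∣ q ∣     ≤⟨ ∣p∣+∣q∣≤n+∣p∩q∣ p q ⟩
    N + ∣ p ∩ q ∣     ∎)
    where
    open ℕ.≤-Reasoning
    arith : ∀ k → 1 + k * 2 + 1 ≡ suc k + suc k
    arith = solve-∀

  -- A union of at most `1 + k` points would be no larger than either set, hence equal to both.
  large-∪ : (p q : Subset N) → Large k p → Large k q → p ≢ q → 2 + k ≤ ∣ p ∪ q ∣
  large-∪ p q lp lq p≢q with (2 + k) ℕ.≤? ∣ p ∪ q ∣
  ... | yes le = le
  ... | no ≰ =
    contradiction (∣p∪q∣≤∣p∣∧∣p∪q∣≤∣q∣⇒p≡q p q (ℕ.≤-trans ∣p∪q∣≤1+k lp) (ℕ.≤-trans ∣p∪q∣≤1+k lq)) p≢q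
    where
    ∣p∪q∣≤1+k = ℕ.s≤s⁻¹ (ℕ.≰⇒> ≰)

  -- This is Hall's condition for two of the pairwise intersections: they share the set `q`, and by
  -- distributivity their union is `q ∩ (p ∪ r)`. The count is (k + 1) + (k + 2) - (2k + 1) = 2.
  large-∩-∪ : (p q r : Subset N) → Large k p → Large k q → Large k r → p ≢ r →
              2 ≤ ∣ q ∩ (p ∪ r) ∣
  large-∩-∪ p q r lp lq lr p≢r = ℕ.+-cancelˡ-≤ N _ _ (begin
    N + 2                   ≡⟨ arith k ⟩
    suc k + (2 + k)         ≤⟨ ℕ.+-mono-≤ lq (large-∪ p r lp lr p≢r) ⟩
    ∣ q ∣ + ∣ p ∪ r ∣       ≤⟨ ∣p∣+∣q∣≤n+∣p∩q∣ q (p ∪ r) ⟩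
    N + ∣ q ∩ (p ∪ r) ∣     ∎)
    where
    open ℕ.≤-Reasoning
    arith : ∀ k → 1 + k * 2 + 2 ≡ suc k + (2 + k)
    arith = solve-∀

-- The points in at least two of the three sets, bracketed as in the last hypothesis of `hall₃` for
-- the pairwise intersections.
majority : (p q r : Subset n) → Subset n
majority p q r = ((p ∩ q) ∪ (q ∩ r)) ∪ (p ∩ r)

-- Inclusion-exclusion is applied to `p`, `q` and then to `p ∪ q`, `r`. Both leftover intersections
-- lie inside the majority.
∣p∣+∣q∣+∣r∣≤n+2∣majority∣ : (p q r : Subset n) →
                            ∣ p ∣ + ∣ q ∣ + ∣ r ∣ ≤ n + (∣ majority p q r ∣ + ∣ majority p q r ∣)
∣p∣+∣q∣+∣r∣≤n+2∣majority∣ {n} p q r = begin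
  ∣ p ∣ + ∣ q ∣ + ∣ r ∣                   ≡⟨ cong (_+ ∣ r ∣) (∣p∪q∣+∣p∩q∣≡∣p∣+∣q∣ p q) ⟨
  ∣ p ∪ q ∣ + ∣ p ∩ q ∣ + ∣ r ∣           ≡⟨ arith (∣ p ∪ q ∣) (∣ p ∩ q ∣) (∣ r ∣) ⟩
  ∣ p ∪ q ∣ + ∣ r ∣ + ∣ p ∩ q ∣           ≤⟨ ℕ.+-monoˡ-≤ ∣ p ∩ q ∣ (∣p∣+∣q∣≤n+∣p∩q∣ (p ∪ q) r) ⟩
  n + ∣ (p ∪ q) ∩ r ∣ + ∣ p ∩ q ∣         ≡⟨ ℕ.+-assoc n _ _ ⟩
  n + (∣ (p ∪ q) ∩ r ∣ + ∣ p ∩ q ∣)       ≤⟨ ℕ.+-monoʳ-≤ n (ℕ.+-mono-≤ (p⊆q⇒∣p∣≤∣q∣ ⊆₁) (p⊆q⇒∣p∣≤∣q∣ ⊆₂)) ⟩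
  n + (∣ majority p q r ∣ + ∣ majority p q r ∣) ∎
  where
  open ℕ.≤-Reasoning
  arith : ∀ a b c → a + b + c ≡ a + c + b
  arith = solve-∀

  ⊆₂ : p ∩ q ⊆ majority p q r
  ⊆₂ = p⊆p∪q (p ∩ r) ∘ p⊆p∪q (q ∩ r)

  ⊆₁ : (p ∪ q) ∩ r ⊆ majority p q r
  ⊆₁ w∈ with w∈p∪q , w∈r ← x∈p∩q⁻ (p ∪ q) r w∈ with x∈p∪q⁻ p q w∈p∪q
  ... | inj₁ w∈p = q⊆p∪q _ _ (x∈p∩q⁺ (w∈p , w∈r))
  ... | inj₂ w∈q = p⊆p∪q _ (q⊆p∪q _ _ (x∈p∩q⁺ (w∈q , w∈r)))

-- For k = 2 the sets {1,2,3}, {1,2,4}, {1,2,5} have majority {1,2}.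
large-majority : ∀ k (p q r : Subset (1 + k * 2)) → 3 ≤ 1 + k * 2 → k ≢ 2 →
                 Large k p → Large k q → Large k r → p ≢ q → q ≢ r → p ≢ r →
                 3 ≤ ∣ majority p q r ∣
large-majority 0 _ _ _ (s≤s ())
large-majority 2 _ _ _ _ k≢2 = contradiction refl k≢2
-- Here n = 3, so each union of two distinct large sets is everything. The majority is also the
-- intersection of the three pairwise unions, hence everything too.
large-majority 1 p q r _ _ lp lq lr p≢q q≢r p≢r = begin
  3                                    ≤⟨ full-∩ (p ∪ q) ((q ∪ r) ∩ (p ∪ r)) (large-∪ p q lp lq p≢q)
                                            (full-∩ (q ∪ r) (p ∪ r) (large-∪ q r lq lr q≢r)
                                                                    (large-∪ p r lp lr p≢r)) ⟩
  ∣ (p ∪ q) ∩ ((q ∪ r) ∩ (p ∪ r)) ∣    ≤⟨ p⊆q⇒∣p∣≤∣q∣ ⊆-majority ⟩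
  ∣ majority p q r ∣                   ∎
  where
  open ℕ.≤-Reasoning

  full-∩ : (s t : Subset 3) → 3 ≤ ∣ s ∣ → 3 ≤ ∣ t ∣ → 3 ≤ ∣ s ∩ t ∣
  full-∩ s t fs ft =
    ℕ.+-cancelˡ-≤ 3 _ _ (ℕ.≤-trans (ℕ.+-mono-≤ fs ft) (∣p∣+∣q∣≤n+∣p∩q∣ s t))

  ⊆-majority : (p ∪ q) ∩ ((q ∪ r) ∩ (p ∪ r)) ⊆ majority p q r
  ⊆-majority w∈ with w∈pq , w∈rest ← x∈p∩q⁻ (p ∪ q) _ w∈
    with w∈qr , w∈pr ← x∈p∩q⁻ (q ∪ r) (p ∪ r) w∈rest
    with x∈p∪q⁻ p q w∈pq | x∈p∪q⁻ q r w∈qr | x∈p∪q⁻ p r w∈pr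
  ... | inj₁ w∈p | inj₁ w∈q | _        = p⊆p∪q _ (p⊆p∪q _ (x∈p∩q⁺ (w∈p , w∈q)))
  ... | inj₁ w∈p | inj₂ w∈r | _        = q⊆p∪q _ _ (x∈p∩q⁺ (w∈p , w∈r))
  ... | inj₂ w∈q | _        | inj₁ w∈p = p⊆p∪q _ (p⊆p∪q _ (x∈p∩q⁺ (w∈p , w∈q)))
  ... | inj₂ w∈q | _        | inj₂ w∈r = p⊆p∪q _ (q⊆p∪q _ _ (x∈p∩q⁺ (w∈q , w∈r)))
-- For k ≥ 3 counting suffices: a majority of at most 2 points would give 3(k + 1) ≤ (2k + 1) + 4,
-- that is k ≤ 2. The excess `suc j` is k - 2.
large-majority (suc (suc (suc j))) p q r _ _ lp lq lr _ _ _ with 3 ℕ.≤? ∣ majority p q r ∣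
... | yes le = le
... | no ≰   = contradiction (begin
  1 + k * 2 + 4 + suc j                  ≡⟨ arith j ⟩
  suc k + suc k + suc k                  ≤⟨ ℕ.+-mono-≤ (ℕ.+-mono-≤ lp lq) lr ⟩
  ∣ p ∣ + ∣ q ∣ + ∣ r ∣                  ≤⟨ ∣p∣+∣q∣+∣r∣≤n+2∣majority∣ p q r ⟩
  1 + k * 2 + (∣ majority p q r ∣ + ∣ majority p q r ∣)
                                         ≤⟨ ℕ.+-monoʳ-≤ (1 + k * 2) (ℕ.+-mono-≤ ≤2 ≤2) ⟩
  1 + k * 2 + 4                          ∎) (ℕ.m+1+n≰m (1 + k * 2 + 4))
  where
  open ℕ.≤-Reasoning
  k = 3 + j

  ≤2 : ∣ majority p q r ∣ ≤ 2
  ≤2 = ℕ.s≤s⁻¹ (ℕ.≰⇒> ≰)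

  arith : ∀ j → 1 + (3 + j) * 2 + 4 + suc j ≡ suc (3 + j) + suc (3 + j) + suc (3 + j)
  arith = solve-∀

large-representatives : ∀ k (p q r : Subset (1 + k * 2)) → 3 ≤ 1 + k * 2 → k ≢ 2 →
                        Large k p → Large k q → Large k r → p ≢ q → q ≢ r → p ≢ r →
                        DistinctRepresentatives (p ∩ q) (q ∩ r) (p ∩ r)
large-representatives k p q r 3≤n k≢2 lp lq lr p≢q q≢r p≢r =
  hall₃ (p ∩ q) (q ∩ r) (p ∩ r)
    (large-∩ p q lp lq) (large-∩ q r lq lr) (large-∩ p r lp lr)
    (ℕ.≤-trans (large-∩-∪ p q r lp lq lr p≢r) (p⊆q⇒∣p∣≤∣q∣ ⊆₁))
    (ℕ.≤-trans (large-∩-∪ q r p lq lr lp (≢-sym p≢q)) (p⊆q⇒∣p∣≤∣q∣ ⊆₂))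
    (ℕ.≤-trans (large-∩-∪ q p r lq lp lr q≢r) (p⊆q⇒∣p∣≤∣q∣ ⊆₃))
    (large-majority k p q r 3≤n k≢2 lp lq lr p≢q q≢r p≢r)
  where
  ⊆₁ : q ∩ (p ∪ r) ⊆ (p ∩ q) ∪ (q ∩ r)
  ⊆₁ w∈ with w∈q , w∈pr ← x∈p∩q⁻ q (p ∪ r) w∈ with x∈p∪q⁻ p r w∈pr
  ... | inj₁ w∈p = p⊆p∪q _ (x∈p∩q⁺ (w∈p , w∈q))
  ... | inj₂ w∈r = q⊆p∪q _ _ (x∈p∩q⁺ (w∈q , w∈r))

  ⊆₂ : r ∩ (q ∪ p) ⊆ (q ∩ r) ∪ (p ∩ r)
  ⊆₂ w∈ with w∈r , w∈qp ← x∈p∩q⁻ r (q ∪ p) w∈ with x∈p∪q⁻ q p w∈qp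
  ... | inj₁ w∈q = p⊆p∪q _ (x∈p∩q⁺ (w∈q , w∈r))
  ... | inj₂ w∈p = q⊆p∪q _ _ (x∈p∩q⁺ (w∈p , w∈r))

  ⊆₃ : p ∩ (q ∪ r) ⊆ (p ∩ q) ∪ (p ∩ r)
  ⊆₃ w∈ with w∈p , w∈qr ← x∈p∩q⁻ p (q ∪ r) w∈ with x∈p∪q⁻ q r w∈qr
  ... | inj₁ w∈q = p⊆p∪q _ (x∈p∩q⁺ (w∈p , w∈q))
  ... | inj₂ w∈r = q⊆p∪q _ _ (x∈p∩q⁺ (w∈p , w∈r))

-- Assembling a Berge triangle from three edges and representatives.

-- The vertex of the triangle that completes x and y; the value at x = y is junk.
third : Fin 3 → Fin 3 → Fin 3
third zero             zero             = zero
third zero             (suc zero)       = suc (suc zero)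
third zero             (suc (suc zero)) = suc zero
third (suc zero)       zero             = suc (suc zero)
third (suc zero)       (suc zero)       = zero
third (suc zero)       (suc (suc zero)) = zero
third (suc (suc zero)) zero             = suc zero
third (suc (suc zero)) (suc zero)       = zero
third (suc (suc zero)) (suc (suc zero)) = zero

third-sym : ∀ x y → third x y ≡ third y x
third-sym = from-yes (all? λ x → all? λ y → third x y Fin.≟ third y x)

-- An unordered pair from three vertices is determined by the vertex it omits. Indexing edges by
-- that vertex therefore reduces distinctness of edges to injectivity of `E`.
third-distinct : ∀ x y u v → x ≢ y → u ≢ v → third x y ≡ third u v →
                 (x ≡ u × y ≡ v) ⊎ (x ≡ v × y ≡ u)
third-distinct = from-yes (all? λ x → all? λ y → all? λ u → all? λ v →
  ¬? (x Fin.≟ y) →-dec ¬? (u Fin.≟ v) →-dec (third x y Fin.≟ third u v) →-dec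
  ((x Fin.≟ u ×-dec y Fin.≟ v) ⊎-dec (x Fin.≟ v ×-dec y Fin.≟ u)))

third≢ : ∀ x y → x ≢ y → third x y ≢ x
third≢ = from-yes (all? λ x → all? λ y → ¬? (x Fin.≟ y) →-dec ¬? (third x y Fin.≟ x))

-- E x is the edge opposite to the vertex φ x.
triangle : {H : Hypergraph n} (φ : Fin 3 → Fin n) (E : Fin 3 → Subset n) →
           Injective _≡_ _≡_ φ → Injective _≡_ _≡_ E →
           (∀ x → H (E x)) → (∀ {x y} → y ≢ x → φ x ∈ E y) → IsBerge (K 3) H
triangle φ E φ-injective E-injective E∈H φ∈E = record
  { φ        = φ
  ; φ-inj    = φ-injective
  ; edge     = λ x y → E (third x y)
  ; edge-sym = λ {x} {y} _ → cong E (third-sym x y)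
  ; edge∈H   = λ {x} {y} _ → E∈H (third x y)
  ; distinct = λ {x} {y} {u} {v} x≢y u≢v eq → third-distinct x y u v x≢y u≢v (E-injective eq)
  ; incident = λ {x} {y} x≢y →
      φ∈E (third≢ x y x≢y) ,
      φ∈E (third≢ y x (≢-sym x≢y) ∘ trans (third-sym y x))
  }

representatives⇒triangle : {H : Hypergraph n} (p q r : Subset n) →
                           p ≢ q → q ≢ r → p ≢ r → H p → H q → H r →
                           DistinctRepresentatives (p ∩ q) (q ∩ r) (p ∩ r) → IsBerge (K 3) H
representatives⇒triangle {H = H} p q r p≢q q≢r p≢r p∈H q∈H r∈H
                         (x , y , z , (x∈ , y∈ , z∈) , (x≢y , y≢z , x≢z)) =
  -- Each vertex is opposite the one set not involved in its intersection: `x` lies in `p ∩ q` and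
  -- faces `r`, `y` faces `p`, `z` faces `q`.
  triangle (choose x y z) (choose r p q)
    (choose-injective x≢y y≢z x≢z) (choose-injective (≢-sym p≢r) p≢q (≢-sym q≢r)) E∈H φ∈E
  where
  E∈H : ∀ i → H (choose r p q i)
  E∈H zero             = r∈H
  E∈H (suc zero)       = p∈H
  E∈H (suc (suc zero)) = q∈H

  φ∈E : ∀ {i j} → j ≢ i → choose x y z i ∈ choose r p q j
  φ∈E {zero}           {zero}           j≢i = contradiction refl j≢i
  φ∈E {zero}           {suc zero}       _   = proj₁ (x∈p∩q⁻ p q x∈)
  φ∈E {zero}           {suc (suc zero)} _   = proj₂ (x∈p∩q⁻ p q x∈)
  φ∈E {suc zero}       {zero}           _   = proj₂ (x∈p∩q⁻ q r y∈)
  φ∈E {suc zero}       {suc zero}       j≢i = contradiction refl j≢i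
  φ∈E {suc zero}       {suc (suc zero)} _   = proj₁ (x∈p∩q⁻ q r y∈)
  φ∈E {suc (suc zero)} {zero}           _   = proj₂ (x∈p∩q⁻ p r z∈)
  φ∈E {suc (suc zero)} {suc zero}       _   = proj₁ (x∈p∩q⁻ p r z∈)
  φ∈E {suc (suc zero)} {suc (suc zero)} j≢i = contradiction refl j≢i

-- The lower bound and the conclusion.

larger : ∀ k → Subset (k * 2) → Subset (1 + k * 2)
larger k p with suc k ℕ.≤? ∣ outside ∷ p ∣
... | yes _ = outside ∷ p
... | no  _ = ∁ (outside ∷ p)

larger-large : ∀ k p → Large k (larger k p)
larger-large k p with suc k ℕ.≤? ∣ outside ∷ p ∣
... | yes large = large
... | no  small = begin
  -- A set that is not large has at most `k` of the 2k + 1 points, leaving at least k + 1 for its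
  -- complement.
  suc k                            ≡⟨ ℕ.m+n∸n≡m (suc k) k ⟨
  suc k + k ∸ k                    ≡⟨ cong (_∸ k) (arith k) ⟩
  1 + k * 2 ∸ k                    ≤⟨ ℕ.∸-monoʳ-≤ (1 + k * 2) (ℕ.s≤s⁻¹ (ℕ.≰⇒> small)) ⟩
  1 + k * 2 ∸ ∣ outside ∷ p ∣      ≡⟨ ∣∁p∣≡n∸∣p∣ (outside ∷ p) ⟨
  ∣ ∁ (outside ∷ p) ∣              ∎
  where
  open ℕ.≤-Reasoning
  arith : ∀ k → suc k + k ≡ 1 + k * 2
  arith = solve-∀

-- Since `half` agrees on complementary sets, it recovers `p` whichever member was selected;
-- injectivity of `larger` follows.
half-larger : ∀ k p → half (larger k p) ≡ p
half-larger k p with suc k ℕ.≤? ∣ outside ∷ p ∣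
... | yes _ = refl
... | no  _ = ∁-involutive p

larger-injective : ∀ k → Injective _≡_ _≡_ (larger k)
larger-injective k {p} {q} eq =
  trans (sym (half-larger k p)) (trans (cong half eq) (half-larger k q))

colours-lower-bound : ∀ k → 3 ≤ 1 + k * 2 → k ≢ 2 →
                      ∀ j → Colourable (1 + k * 2) (𝓑 (K 3)) j → 2 ^ (k * 2) ≤ j * 2
colours-lower-bound k 3≤n k≢2 j (c , no-triangle) = at-most-two-to-one⇒≤ (c ∘ large)
  λ {x} {y} {z} x≢y y≢z x≢z cx≡cy cy≡cz → no-triangle (c (large y))
    ( colourClass c (c (large y)) , (λ same → same)
    , representatives⇒triangle (large x) (large y) (large z)
        (x≢y ∘ large-injective) (y≢z ∘ large-injective) (x≢z ∘ large-injective)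
        cx≡cy refl (sym cy≡cz)
        (large-representatives k (large x) (large y) (large z) 3≤n k≢2
          (large-large x) (large-large y) (large-large z)
          (x≢y ∘ large-injective) (y≢z ∘ large-injective) (x≢z ∘ large-injective)))
  where
  large : Fin (2 ^ (k * 2)) → Subset (1 + k * 2)
  large = larger k ∘ Inverse.from (subset↔fin (k * 2))

  large-large : ∀ x → Large k (large x)
  large-large x = larger-large k (Inverse.from (subset↔fin (k * 2)) x)

  large-injective : Injective _≡_ _≡_ large
  large-injective = Injection.injective (↔⇒↣ (↔-sym (subset↔fin (k * 2)))) ∘ larger-injective k

theorem1 : ∀ (n : ℕ) → n % 2 ≡ 1 → 3 ≤ n → n ≢ 5 → f[ n , 𝓑 (K 3) ]≡ (2 ^ (n ∸ 2))
theorem1 n odd 3≤n n≢5 =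
  odd-case (n / 2) (trans (m≡m%n+[m/n]*n n 2) (cong (_+ n / 2 * 2) odd)) 3≤n n≢5
  where
  odd-case : ∀ {n} k → n ≡ 1 + k * 2 → 3 ≤ n → n ≢ 5 → f[ n , 𝓑 (K 3) ]≡ (2 ^ (n ∸ 2))
  odd-case zero refl (s≤s ()) _
  odd-case k@(suc i) refl 3≤n n≢5 =
    colourable-2^ (1 + i * 2) ,
    -- With k = i + 1, `2 ^ (k * 2)` unfolds to twice `2 ^ (1 + i * 2)`, and `n ∸ 2` is `1 + i * 2`;
    -- cancelling the factor 2 leaves the claimed bound.
    λ j colourable → ℕ.*-cancelʳ-≤ _ _ 2
      (subst (_≤ j * 2) (ℕ.*-comm 2 (2 ^ (1 + i * 2)))
        (colours-lower-bound k 3≤n (λ k≡2 → n≢5 (cong (λ k → 1 + k * 2) k≡2)) j colourable))
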